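{- For every message $M$ and formulas $\phi,\psi$: $\vdash[M]\big([M](\phi\vee\psi)\to([M]\phi\vee[M]\psi)\big)$.
   Context: Fix a finite set $\mathcal{A}$ of agent names containing a distinguished name $\mathsf{CM}$. Messages: $M ::= a \mid B \mid (M,M)$ ($a\in\mathcal{A}$, $B$ optional data constants, pairs). $\mathcal{P}$ is a denumerable set of propositional variables containing atoms $\mathsf{k}_a(M)$ ("$a$ knows $M$"). Formulas: $\phi ::= P \mid \phi\wedge\phi \mid \phi\vee\phi \mid \neg\phi \mid \phi\to\phi \mid [M]\phi$. Abbreviations: $\mathrm{true}:=\mathsf{k}_{\mathsf{CM}}(\mathsf{CM})$, $\mathrm{false}:=\neg\mathrm{true}$, $\phi\leftrightarrow\psi:=(\phi\to\psi)\wedge(\psi\to\phi)$, $\langle M\rangle\phi:=\neg\neg(\mathsf{k}_{\mathsf{CM}}(M)\wedge\phi)$. LIiP is the smallest set of formulas containing all instances of: the axioms of an adequate Hilbert axiomatization of intuitionistic propositional logic; $\mathsf{k}_a(a)$; $(\mathsf{k}_a(M)\wedge\mathsf{k}_a(M'))\leftrightarrow\mathsf{k}_a((M,M'))$; $[M]\mathsf{k}_{\mathsf{CM}}(M)$; $[M](\phi\to\psi)\to([M]\phi\to[M]\psi)$; $[M]\phi\to(\mathsf{k}_{\mathsf{CM}}(M)\to\phi)$; $[M]\phi\to\langle M\rangle\phi$; $\phi\to[M]\phi$; and closed under modus ponens and the rule: if $\mathsf{k}_{\mathsf{CM}}(M)\to\mathsf{k}_{\mathsf{CM}}(M')$ is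 in the set then so is $[M']\phi\to[M]\phi$ for every $\phi$. Write $\vdash\phi$ for $\phi\in\mathrm{LIiP}$. -}

module Defs where

open import Data.Fin using (Fin)
open import Data.Nat using (ℕ)
open import Data.Product using (∃-syntax; uncurry)
open import Function.Bundles using (_↔_)
open import Function.Definitions using (Injective)
open import Relation.Binary.PropositionalEquality using (_≡_)

data Msg (Agent Data : Set) : Set where
  agent : Agent → Msg Agent Data
  datum : Data → Msg Agent Data
  pair  : Msg Agent Data → Msg Agent Data → Msg Agent Data

record Signature : Set₁ where
  field
    Agent        : Set
    Agent-finite : ∃[ n ] (Agent ↔ Fin n)
    CM           : Agent
    -- Data constants are optional, so Data may be empty.
    Data         : Set
    PVar         : Set
    PVar-denum   : PVar ↔ ℕ
    -- The atoms k a M are pairwise distinct members of PVar, which may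
    -- contain further variables.
    k            : Agent → Msg Agent Data → PVar
    k-injective  : Injective _≡_ _≡_ (uncurry k)

module LIiP (S : Signature) where
  open Signature S

  Message : Set
  Message = Msg Agent Data

  infix  9 ¬_ [_]_ ⟨_⟩_
  infixr 7 _∧_
  infixr 6 _∨_
  infixr 5 _⇒_
  infix  4 _⇔_
  infix  3 ⊢_

  data Formula : Set where
    var  : PVar → Formula
    _∧_  : Formula → Formula → Formula
    _∨_  : Formula → Formula → Formula
    ¬_   : Formula → Formula
    _⇒_  : Formula → Formula → Formula
    [_]_ : Message → Formula → Formula

  knows : Agent → Message → Formula
  knows a M = var (k a M)

  _⇔_ : Formula → Formula → Formula
  φ ⇔ ψ = (φ ⇒ ψ) ∧ (ψ ⇒ φ)

  ⟨_⟩_ : Message → Formula → Formula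
  ⟨ M ⟩ φ = ¬ (¬ (knows CM M ∧ φ))

  data ⊢_ : Formula → Set where
    -- Intuitionistic propositional logic with primitive negation: Kleene's
    -- axioms, with ex falso in place of double-negation elimination.
    ⇒-K    : ∀ φ ψ → ⊢ φ ⇒ (ψ ⇒ φ)
    ⇒-S    : ∀ φ ψ χ → ⊢ (φ ⇒ (ψ ⇒ χ)) ⇒ ((φ ⇒ ψ) ⇒ (φ ⇒ χ))
    ∧-elimˡ : ∀ φ ψ → ⊢ (φ ∧ ψ) ⇒ φ
    ∧-elimʳ : ∀ φ ψ → ⊢ (φ ∧ ψ) ⇒ ψ
    ∧-intro : ∀ φ ψ → ⊢ φ ⇒ (ψ ⇒ (φ ∧ ψ))
    ∨-introˡ : ∀ φ ψ → ⊢ φ ⇒ (φ ∨ ψ)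
    ∨-introʳ : ∀ φ ψ → ⊢ ψ ⇒ (φ ∨ ψ)
    ∨-elim  : ∀ φ ψ χ → ⊢ (φ ⇒ χ) ⇒ ((ψ ⇒ χ) ⇒ ((φ ∨ ψ) ⇒ χ))
    ¬-intro : ∀ φ ψ → ⊢ (φ ⇒ ψ) ⇒ ((φ ⇒ (¬ ψ)) ⇒ (¬ φ))
    ¬-elim  : ∀ φ ψ → ⊢ (¬ φ) ⇒ (φ ⇒ ψ)

    k-self : ∀ a → ⊢ knows a (agent a)
    k-pair : ∀ a M M′ → ⊢ (knows a M ∧ knows a M′) ⇔ knows a (pair M M′)

    []-self : ∀ M → ⊢ [ M ] (knows CM M)
    []-K    : ∀ M φ ψ → ⊢ ([ M ] (φ ⇒ ψ)) ⇒ (([ M ] φ) ⇒ ([ M ] ψ))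
    []-T    : ∀ M φ → ⊢ ([ M ] φ) ⇒ (knows CM M ⇒ φ)
    []-⟨⟩   : ∀ M φ → ⊢ ([ M ] φ) ⇒ (⟨ M ⟩ φ)
    []-unit : ∀ M φ → ⊢ φ ⇒ ([ M ] φ)

    mp : ∀ {φ ψ} → ⊢ φ ⇒ ψ → ⊢ φ → ⊢ ψ
    []-antitone : ∀ {M M′} → ⊢ knows CM M ⇒ knows CM M′ →
                  ∀ φ → ⊢ ([ M′ ] φ) ⇒ ([ M ] φ)

{-# OPTIONS --safe #-}

-- Under the assumption k_CM(M), every [M]χ is equivalent to χ: one direction is
-- [M]χ → (k_CM(M) → χ), the other χ → [M]χ. Hence k_CM(M) implies the
-- distribution of [M] over ∨, and since [M]k_CM(M) is an axiom, the normality of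
-- [M] turns this assumption into the outer box.

module Submission where

open import Defs

module Derived (S : Signature) where
  open Signature S
  open LIiP S

  ⇒-const : ∀ {φ ψ} → ⊢ ψ → ⊢ φ ⇒ ψ
  ⇒-const p = mp (⇒-K _ _) p

  ⇒-ap : ∀ {φ ψ χ} → ⊢ φ ⇒ (ψ ⇒ χ) → ⊢ φ ⇒ ψ → ⊢ φ ⇒ χ
  ⇒-ap p q = mp (mp (⇒-S _ _ _) p) q

  ⇒-trans : ∀ {φ ψ χ} → ⊢ φ ⇒ ψ → ⊢ ψ ⇒ χ → ⊢ φ ⇒ χ
  ⇒-trans p q = ⇒-ap (⇒-const q) p

  ⇒-swap : ∀ {φ ψ χ} → ⊢ φ ⇒ (ψ ⇒ χ) → ⊢ ψ ⇒ (φ ⇒ χ)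
  -- `⇒-S` turns `p` into `(φ ⇒ ψ) ⇒ (φ ⇒ χ)`, whose premise `⇒-K` supplies from `ψ`.
  ⇒-swap p = ⇒-trans (⇒-K _ _) (mp (⇒-S _ _ _) p)

  ⇒-monoʳ : ∀ {φ ψ χ} → ⊢ ψ ⇒ χ → ⊢ (φ ⇒ ψ) ⇒ (φ ⇒ χ)
  ⇒-monoʳ p = mp (⇒-S _ _ _) (⇒-const p)

  ∨-mono : ∀ {φ ψ φ′ ψ′} → ⊢ φ ⇒ φ′ → ⊢ ψ ⇒ ψ′ → ⊢ (φ ∨ ψ) ⇒ (φ′ ∨ ψ′)
  ∨-mono p q = mp (mp (∨-elim _ _ _) (⇒-trans p (∨-introˡ _ _)))
                  (⇒-trans q (∨-introʳ _ _))

  -- A converse to `[]-T` for theorems: `[]-unit` boxes the derived implication itself, so that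
  -- `[]-K` can apply it to `[]-self`.
  []-intro : ∀ {M φ} → ⊢ knows CM M ⇒ φ → ⊢ [ M ] φ
  []-intro p = mp (mp ([]-K _ _ _) (mp ([]-unit _ _) p)) ([]-self _)

theorem2p41 : (S : Signature) → let open LIiP S in
    (M : Message) (φ ψ : Formula) →
    ⊢ [ M ] (([ M ] (φ ∨ ψ)) ⇒ (([ M ] φ) ∨ ([ M ] ψ)))
theorem2p41 S M φ ψ =
  -- Only the unboxing uses `knows CM M`, so it is moved to the front; each disjunct is then boxed
  -- again unconditionally.
  []-intro (⇒-trans (⇒-swap ([]-T M (φ ∨ ψ)))
                    (⇒-monoʳ (∨-mono ([]-unit M φ) ([]-unit M ψ))))
  where
    open LIiP S
    open Derived S
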